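{- Let $(\mathsf P,\mathcal O)$ be a semitopology and $p\in\mathsf P$. The following are equivalent: (1) $p$ is regular, i.e. $p\in K(p)$ and $K(p)$ is topen; (2) $K(p)$ is a greatest topen neighbourhood of $p$; (3) $K(p)$ is a maximal topen neighbourhood of $p$; (4) $p$ has a maximal topen neighbourhood; (5) $p$ has some topen neighbourhood (a topen set containing $p$).
   Context: A semitopology is a pair $(\mathsf P,\mathcal O)$ where $\mathsf P$ is a set and $\mathcal O\subseteq\mathcal P(\mathsf P)$ contains $\varnothing$ and $\mathsf P$ and is closed under arbitrary unions. Write $X\between Y$ when $X\cap Y\neq\varnothing$. A set $T$ is transitive when for all $O,O'\in\mathcal O$, $O\between T\between O'$ implies $O\between O'$; topen means nonempty, open and transitive. Points $p,p'$ are intertwined when every open set containing $p$ intersects every open set containing $p'$; $I(p)$ denotes the set of points intertwined with $p$. The interior $\mathrm{int}(R)$ of $R\subseteq\mathsf P$ is the union of all open sets contained in $R$. The community of $p$ is $K(p)=\mathrm{int}(I(p))$. A topen neighbourhood of $p$ is a topen set containing $p$. -}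

module Defs where

open import Level using (Level; suc; _⊔_)
open import Data.Product using (∃; Σ; _×_; _,_)
open import Relation.Unary using (Pred; _∈_; _⊆_; _≐_; _≬_; ∅; U; ⋃; Satisfiable)

private
  variable
    ℓ r s : Level

-- The set of open sets is given as a family 𝒪 of subsets indexed by a type in
-- the same universe as the points, rather than as a predicate on Pred P ℓ.  The
-- latter would make a quantification over open sets raise the universe level,
-- so that the community of a point, which is defined by such a quantification,
-- would no longer be a candidate open set.
record Semitopology (P : Set ℓ) : Set (suc ℓ) where
  field
    𝒪   : Set ℓ
    ⟦_⟧ : 𝒪 → Pred P ℓ

  -- Subsets are compared extensionally, so X belongs to the family as soon as
  -- it has the same elements as one of its members.
  Open : Pred P r → Set (ℓ ⊔ r)
  Open X = ∃ λ O → ⟦ O ⟧ ≐ X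

  field
    ∅-open : Open ∅
    U-open : Open U
    ⋃-open : {J : Set ℓ} (X : J → Pred P ℓ) → (∀ j → Open (X j)) → Open (⋃ J X)

module _ {P : Set ℓ} (S : Semitopology P) where
  open Semitopology S

  -- "X meets Y" is the library's X ≬ Y, which asks for a common element.
  Transitive : Pred P ℓ → Set ℓ
  Transitive T = ∀ O O′ → ⟦ O ⟧ ≬ T → T ≬ ⟦ O′ ⟧ → ⟦ O ⟧ ≬ ⟦ O′ ⟧

  Topen : Pred P ℓ → Set ℓ
  Topen T = Satisfiable T × Open T × Transitive T

  Intertwined : P → P → Set ℓ
  Intertwined p p′ = ∀ O O′ → p ∈ ⟦ O ⟧ → p′ ∈ ⟦ O′ ⟧ → ⟦ O ⟧ ≬ ⟦ O′ ⟧

  I : P → Pred P ℓ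
  I p p′ = Intertwined p p′

  int : Pred P ℓ → Pred P ℓ
  int R = ⋃ (Σ 𝒪 λ O → ⟦ O ⟧ ⊆ R) (λ (O , _) → ⟦ O ⟧)

  K : P → Pred P ℓ
  K p = int (I p)

  Regular : P → Set ℓ
  Regular p = p ∈ K p × Topen (K p)

  TopenNeighbourhood : P → Pred P ℓ → Set ℓ
  TopenNeighbourhood p T = Topen T × p ∈ T

module _ {P : Set ℓ} (Φ : Pred P ℓ → Set s) where

  Greatest : Pred P ℓ → Set (suc ℓ ⊔ s)
  Greatest X = Φ X × (∀ Y → Φ Y → Y ⊆ X)

  Maximal : Pred P ℓ → Set (suc ℓ ⊔ s)
  Maximal X = Φ X × (∀ Y → Φ Y → X ⊆ Y → Y ≐ X)

{-# OPTIONS --safe #-}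
-- If T is a topen neighbourhood of p, then transitivity gives T ⊆ I(p), hence
-- T ⊆ K(p) as T is open.  Conversely every point of I(p) has only
-- neighbourhoods that meet T, so K(p) inherits the transitivity of T.  One
-- topen neighbourhood thus makes K(p) the greatest one.
module Submission where

open import Data.Product using (∃; _×_; _,_; proj₁; proj₂; map₂; swap)
open import Function.Base using (id; _∘_)
open import Function.Bundles using (_⇔_; mk⇔)
open import Level using (Level)
open import Relation.Unary using (Pred; _∈_; _⊆_; _≬_)
open import Relation.Unary.Properties using (≬-sym)
open import Defs

private
  variable
    ℓ s : Level

Greatest⇒Maximal : {P : Set ℓ} {Φ : Pred P ℓ → Set s} {X : Pred P ℓ} →
  Greatest Φ X → Maximal Φ X
Greatest⇒Maximal (ΦX , greatest) = ΦX , λ Y ΦY X⊆Y → greatest Y ΦY , X⊆Y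

module _ {P : Set ℓ} (S : Semitopology P) where
  open Semitopology S

  int-open : ∀ R → Open (int S R)
  int-open R = ⋃-open _ λ (O , _) → O , id , id

  open-⊆-int : {T R : Pred P ℓ} → Open T → T ⊆ R → T ⊆ int S R
  open-⊆-int (O , O⊆T , T⊆O) T⊆R x∈T = (O , T⊆R ∘ O⊆T) , T⊆O x∈T

  int-⊆ : ∀ {R} → int S R ⊆ R
  int-⊆ ((_ , O⊆R) , x∈O) = O⊆R x∈O

  -- The points `p` and `q` themselves witness that `O` and `O′` meet `T`.
  transitive-⊆-I : ∀ {p T} → Transitive S T → p ∈ T → T ⊆ I S p
  transitive-⊆-I trans p∈T q∈T O O′ p∈O q∈O′ =
    trans O O′ (_ , p∈O , p∈T) (_ , q∈T , q∈O′)

  -- `T` has the same elements as a member `N` of the family, and `N` is an open set around `p` to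
  -- which intertwinedness with `q` applies.
  open-meets-neighbourhood : ∀ {p q} {T : Pred P ℓ} → Open T → p ∈ T → q ∈ I S p →
    ∀ O → q ∈ ⟦ O ⟧ → T ≬ ⟦ O ⟧
  open-meets-neighbourhood (N , N⊆T , T⊆N) p∈T q∈I O q∈O
    with x , x∈N , x∈O ← q∈I N O (T⊆N p∈T) q∈O = x , N⊆T x∈N , x∈O

  -- `T` serves as a bridge: an open set meeting `K S p` contains a point intertwined with `p`,
  -- hence meets `T`.
  K-transitive : ∀ {p T} → TopenNeighbourhood S p T → Transitive S (K S p)
  K-transitive ((_ , T-open , trans) , p∈T) O O′ (_ , x∈O , x∈K) (_ , y∈K , y∈O′) =
    trans O O′
      (≬-sym (open-meets-neighbourhood T-open p∈T (int-⊆ x∈K) O x∈O))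
      (open-meets-neighbourhood T-open p∈T (int-⊆ y∈K) O′ y∈O′)

  topenNeighbourhood-⊆-K : ∀ {p T} → TopenNeighbourhood S p T → T ⊆ K S p
  topenNeighbourhood-⊆-K ((_ , T-open , trans) , p∈T) =
    open-⊆-int T-open (transitive-⊆-I trans p∈T)

  K-greatest : ∀ {p} → (∃ λ T → TopenNeighbourhood S p T) →
    Greatest (TopenNeighbourhood S p) (K S p)
  K-greatest {p} (_ , nbhd@(_ , p∈T)) =
    -- The point `p` itself witnesses that `K S p` is nonempty.
    (((p , p∈K) , int-open (I S p) , K-transitive nbhd) , p∈K) ,
    λ _ → topenNeighbourhood-⊆-K
    where
    p∈K : p ∈ K S p
    p∈K = topenNeighbourhood-⊆-K nbhd p∈T

theorem4p12 : ∀ {ℓ} {P : Set ℓ} (S : Semitopology P) (p : P) →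
    (Regular S p ⇔ Greatest (TopenNeighbourhood S p) (K S p)) ×
    (Greatest (TopenNeighbourhood S p) (K S p) ⇔ Maximal (TopenNeighbourhood S p) (K S p)) ×
    (Maximal (TopenNeighbourhood S p) (K S p) ⇔ (∃ λ T → Maximal (TopenNeighbourhood S p) T)) ×
    ((∃ λ T → Maximal (TopenNeighbourhood S p) T) ⇔ (∃ λ T → TopenNeighbourhood S p T))
theorem4p12 S p =
  -- `Regular S p` and `TopenNeighbourhood S p (K S p)` are the same pair in opposite orders, hence
  -- `swap`.
  mk⇔ (λ regular → K-greatest S (_ , swap regular)) (swap ∘ proj₁) ,
  mk⇔ Greatest⇒Maximal (λ maximal → K-greatest S (_ , proj₁ maximal)) ,
  mk⇔ (K S p ,_) (K-maximal ∘ map₂ proj₁) ,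
  mk⇔ (map₂ proj₁) (λ nbhd → K S p , K-maximal nbhd)
  where
  -- Leads from the weakest condition back to the stronger ones, for the converses in the last two
  -- equivalences.
  K-maximal : (∃ λ T → TopenNeighbourhood S p T) → Maximal (TopenNeighbourhood S p) (K S p)
  K-maximal = Greatest⇒Maximal ∘ K-greatest S
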